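{- Let $X\subseteq\mathbb{Z}^2\setminus\{O\}$ be an arbitrary (finite or infinite) step set. Then the following are equivalent: (i) $X$ has the Infinite Paths Property (IPP); (ii) $O\in\operatorname{Conv}(X)$; (iii) the monoid $\mathcal{A}_X$ has non-trivial units (i.e. an invertible element other than $O$); (iv) the digraph $\Gamma_X$ has non-trivial directed cycles.
   Context: Write $O=(0,0)$ and $\mathbb{N}=\{0,1,2,\ldots\}$. A step set is any subset $X$ of $\mathbb{Z}^2\setminus\{O\}$ (finite or infinite, possibly empty). $\mathcal{F}_X$ is the free monoid on $X$: all words $A_1\cdots A_k$ ($k\in\mathbb{N}$, $A_i\in X$), including the empty word. $\mathcal{A}_X$ is the additive submonoid of $\mathbb{Z}^2$ generated by $X$, with identity $O$. The surjective homomorphism $\alpha_X:\mathcal{F}_X\to\mathcal{A}_X$ is $\alpha_X(A_1\cdots A_k)=A_1+\cdots+A_k$. For $A\in\mathbb{Z}^2$, $\pi_X(A)\in\mathbb{N}\cup\{\infty\}$ is the number of words $w\in\mathcal{F}_X$ with $\alpha_X(w)=A$. $X$ has the IPP if $\pi_X(A)=\infty$ for all $A\in\mathcal{A}_X$. $\operatorname{Conv}(X)$ is the convex hull of $X$ in $\mathbb{R}^2$ (the set of all convex combinations of finite collections of points of $X$). $\Gamma_X$ is the digraph with vertex set $\mathcal{A}_X$ and with an edge, labelled $B$, from $A$ to $A+B$ for each $A\in\mathcal{A}_X$ and each $B\in X$. A non-trivial directed cycle is a closed directed path with at least one edge. -}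

module Defs where

open import Algebra.Bundles using (Monoid; RawMonoid)
open import Algebra.Construct.DirectProduct using (rawMonoid)
open import Algebra.Core using (Op₂)
open import Algebra.Definitions using (Invertible)
open import Algebra.Definitions.RawMonoid using (sum)
open import Data.Fin.Base using (Fin)
open import Data.Integer.Base as ℤ using (ℤ; 0ℤ)
import Data.Integer.Properties as ℤ
open import Data.List.Base using (List; foldr)
open import Data.List.Relation.Unary.All using (All)
open import Data.Nat.Base as ℕ using (ℕ; _⊔_)
import Data.Nat.Properties as ℕ
open import Data.Product.Base using (Σ; ∃; ∃-syntax; _×_; _,_; proj₁; proj₂)
open import Data.Rational.Base as ℚ
  using (ℚ; 0ℚ; 1ℚ; ½; Positive; 1/_; NonZero; NonNegative; ∣_∣)
import Data.Rational.Properties as ℚ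
open import Data.Rational.Solver using (module +-*-Solver)
open import Function.Definitions using (Injective)
open import Level using (Level; 0ℓ)
open import Relation.Binary.Construct.Closure.Transitive using (TransClosure)
open import Relation.Binary.Core using (Rel)
open import Relation.Binary.PropositionalEquality
  using (_≡_; refl; sym; trans; cong; cong₂; subst)
open import Relation.Nullary.Negation using (¬_)
open import Relation.Unary using (Pred; _∈_)

private
  variable
    a ℓ : Level

-- A real number is a Cauchy sequence of rationals; _≈ᴿ_ plays the role of
-- equality of reals.

Cauchy : (ℕ → ℚ) → Set
Cauchy s = ∀ ε → .{{Positive ε}} →
  ∃[ N ] ∀ m n → N ℕ.≤ m → N ℕ.≤ n → ∣ s m ℚ.- s n ∣ ℚ.≤ ε

record ℝ : Set where
  constructor mkℝ
  field
    seq    : ℕ → ℚ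
    cauchy : Cauchy seq

open ℝ public

infix 4 _≈ᴿ_ _≤ᴿ_

_≈ᴿ_ : Rel ℝ 0ℓ
x ≈ᴿ y = ∀ ε → .{{Positive ε}} →
  ∃[ N ] ∀ n → N ℕ.≤ n → ∣ seq x n ℚ.- seq y n ∣ ℚ.≤ ε

-- The slack ε is what makes this the order of the limits: termwise
-- comparison would not respect _≈ᴿ_.
_≤ᴿ_ : Rel ℝ 0ℓ
x ≤ᴿ y = ∀ ε → .{{Positive ε}} →
  ∃[ N ] ∀ n → N ℕ.≤ n → seq x n ℚ.≤ seq y n ℚ.+ ε

private
  half-pos : ∀ ε → .{{Positive ε}} → Positive (½ ℚ.* ε)
  half-pos ε = ℚ.pos*pos⇒pos ½ ε

  half+half : ∀ ε → ½ ℚ.* ε ℚ.+ ½ ℚ.* ε ≡ ε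
  half+half = solve 1 (λ e → con ½ :* e :+ con ½ :* e := e) refl
    where open +-*-Solver

  +-regroup : ∀ p q r s → (p ℚ.+ q) ℚ.- (r ℚ.+ s) ≡ (p ℚ.- r) ℚ.+ (q ℚ.- s)
  +-regroup = solve 4 (λ p q r s →
      (p :+ q) :- (r :+ s) := (p :- r) :+ (q :- s)) refl
    where open +-*-Solver

  *-regroup : ∀ p q r s →
    (p ℚ.* q) ℚ.- (r ℚ.* s) ≡ p ℚ.* (q ℚ.- s) ℚ.+ (p ℚ.- r) ℚ.* s
  *-regroup = solve 4 (λ p q r s →
      (p :* q) :- (r :* s) := p :* (q :- s) :+ (p :- r) :* s) refl
    where open +-*-Solver

  sub-add : ∀ p q → p ≡ (p ℚ.- q) ℚ.+ q
  sub-add = solve 2 (λ p q → p := (p :- q) :+ q) refl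
    where open +-*-Solver

  ∣0∣≤ : ∀ p ε → .{{Positive ε}} → ∣ p ℚ.- p ∣ ℚ.≤ ε
  ∣0∣≤ p ε rewrite ℚ.+-inverseʳ p = ℚ.<⇒≤ (ℚ.positive⁻¹ ε)

  ∣+∣≤ : ∀ {p q r s} → ∣ p ∣ ℚ.≤ r → ∣ q ∣ ℚ.≤ s → ∣ p ℚ.+ q ∣ ℚ.≤ r ℚ.+ s
  ∣+∣≤ {p} {q} p≤r q≤s = ℚ.≤-trans (ℚ.∣p+q∣≤∣p∣+∣q∣ p q) (ℚ.+-mono-≤ p≤r q≤s)

  ∣*∣≤ : ∀ {p q r s} → .{{NonNegative r}} →
         ∣ p ∣ ℚ.≤ r → ∣ q ∣ ℚ.≤ s → ∣ p ℚ.* q ∣ ℚ.≤ r ℚ.* s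
  ∣*∣≤ {p} {q} {r} {s} p≤r q≤s = begin
    ∣ p ℚ.* q ∣      ≡⟨ ℚ.∣p*q∣≡∣p∣*∣q∣ p q ⟩
    ∣ p ∣ ℚ.* ∣ q ∣  ≤⟨ ℚ.*-monoʳ-≤-nonNeg ∣ q ∣ {{ℚ.∣-∣-nonNeg q}} p≤r ⟩
    r ℚ.* ∣ q ∣      ≤⟨ ℚ.*-monoˡ-≤-nonNeg r q≤s ⟩
    r ℚ.* s          ∎
    where open ℚ.≤-Reasoning

  bounded : ∀ {s} → Cauchy s →
    ∃[ M ] Positive M × (∃[ N ] ∀ n → N ℕ.≤ n → ∣ s n ∣ ℚ.≤ M)
  bounded {s} c with c 1ℚ
  ... | N , close = 1ℚ ℚ.+ ∣ s N ∣
      , ℚ.pos+nonNeg⇒pos 1ℚ ∣ s N ∣ {{ℚ.∣-∣-nonNeg (s N)}}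
      , N
      , λ n N≤n → subst (λ t → ∣ t ∣ ℚ.≤ 1ℚ ℚ.+ ∣ s N ∣)
                    (sym (sub-add (s n) (s N)))
                    (∣+∣≤ {s n ℚ.- s N} {s N}
                      (close n N N≤n ℕ.≤-refl) ℚ.≤-refl)

  +-cauchy : ∀ s t → Cauchy s → Cauchy t → Cauchy (λ n → s n ℚ.+ t n)
  +-cauchy s t cs ct ε
    with cs (½ ℚ.* ε) {{half-pos ε}} | ct (½ ℚ.* ε) {{half-pos ε}}
  ... | N₁ , h₁ | N₂ , h₂ = N₁ ⊔ N₂ , λ m n N≤m N≤n → begin
    ∣ (s m ℚ.+ t m) ℚ.- (s n ℚ.+ t n) ∣
      ≡⟨ cong ∣_∣ (+-regroup (s m) (t m) (s n) (t n)) ⟩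
    ∣ (s m ℚ.- s n) ℚ.+ (t m ℚ.- t n) ∣
      ≤⟨ ∣+∣≤ {s m ℚ.- s n} {t m ℚ.- t n}
           (h₁ m n (ℕ.m⊔n≤o⇒m≤o N₁ N₂ N≤m) (ℕ.m⊔n≤o⇒m≤o N₁ N₂ N≤n))
           (h₂ m n (ℕ.m⊔n≤o⇒n≤o N₁ N₂ N≤m) (ℕ.m⊔n≤o⇒n≤o N₁ N₂ N≤n)) ⟩
    ½ ℚ.* ε ℚ.+ ½ ℚ.* ε
      ≡⟨ half+half ε ⟩
    ε ∎
    where open ℚ.≤-Reasoning

  split : ∀ M ε → .{{Positive M}} → .{{Positive ε}} →
    ∃[ δ ] Positive δ × M ℚ.* δ ≡ ε
  split M ε = 1/ M ℚ.* ε
    , ℚ.pos*pos⇒pos (1/ M) {{ℚ.1/pos⇒pos M}} ε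
    , trans (sym (ℚ.*-assoc M (1/ M) ε))
        (trans (cong (ℚ._* ε) (ℚ.*-inverseʳ M)) (ℚ.*-identityˡ ε))
    where
    instance
      M-nonZero : NonZero M
      M-nonZero = ℚ.pos⇒nonZero M

  *-close : ∀ {p q r s A B δ} → .{{Positive A}} → .{{Positive δ}} →
    ∣ p ∣ ℚ.≤ A → ∣ s ∣ ℚ.≤ B → ∣ q ℚ.- s ∣ ℚ.≤ δ → ∣ p ℚ.- r ∣ ℚ.≤ δ →
    ∣ p ℚ.* q ℚ.- r ℚ.* s ∣ ℚ.≤ (A ℚ.+ B) ℚ.* δ
  *-close {p} {q} {r} {s} {A} {B} {δ} p≤A s≤B q-s p-r = begin
    ∣ p ℚ.* q ℚ.- r ℚ.* s ∣
      ≡⟨ cong ∣_∣ (*-regroup p q r s) ⟩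
    ∣ p ℚ.* (q ℚ.- s) ℚ.+ (p ℚ.- r) ℚ.* s ∣
      ≤⟨ ∣+∣≤ {p ℚ.* (q ℚ.- s)} {(p ℚ.- r) ℚ.* s}
           (∣*∣≤ {p} {q ℚ.- s} {{ℚ.pos⇒nonNeg A}} p≤A q-s)
           (∣*∣≤ {p ℚ.- r} {s} {{ℚ.pos⇒nonNeg δ}} p-r s≤B) ⟩
    A ℚ.* δ ℚ.+ δ ℚ.* B
      ≡⟨ cong (A ℚ.* δ ℚ.+_) (ℚ.*-comm δ B) ⟩
    A ℚ.* δ ℚ.+ B ℚ.* δ
      ≡⟨ sym (ℚ.*-distribʳ-+ δ A B) ⟩
    (A ℚ.+ B) ℚ.* δ ∎
    where open ℚ.≤-Reasoning

  *-cauchy : ∀ s t → Cauchy s → Cauchy t → Cauchy (λ n → s n ℚ.* t n)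
  *-cauchy s t cs ct ε =
    let A , posA , N₁ , bs = bounded cs
        B , posB , N₂ , bt = bounded ct
        δ , posδ , eq =
          split (A ℚ.+ B) ε {{ℚ.pos+pos⇒pos A {{posA}} B {{posB}}}}
        N₃ , h₁ = cs δ {{posδ}}
        N₄ , h₂ = ct δ {{posδ}}
        l₁₂ = ℕ.m≤m⊔n (N₁ ⊔ N₂) (N₃ ⊔ N₄)
        l₃₄ = ℕ.m≤n⊔m (N₁ ⊔ N₂) (N₃ ⊔ N₄)
        l₁ = ℕ.≤-trans (ℕ.m≤m⊔n N₁ N₂) l₁₂
        l₂ = ℕ.≤-trans (ℕ.m≤n⊔m N₁ N₂) l₁₂
        l₃ = ℕ.≤-trans (ℕ.m≤m⊔n N₃ N₄) l₃₄
        l₄ = ℕ.≤-trans (ℕ.m≤n⊔m N₃ N₄) l₃₄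
    in (N₁ ⊔ N₂) ⊔ (N₃ ⊔ N₄) , λ m n N≤m N≤n →
       subst (∣ s m ℚ.* t m ℚ.- s n ℚ.* t n ∣ ℚ.≤_) eq
         (*-close {s m} {t m} {s n} {t n} {A} {B} {δ} {{posA}} {{posδ}}
           (bs m (ℕ.≤-trans l₁ N≤m)) (bt n (ℕ.≤-trans l₂ N≤n))
           (h₂ m n (ℕ.≤-trans l₄ N≤m) (ℕ.≤-trans l₄ N≤n))
           (h₁ m n (ℕ.≤-trans l₃ N≤m) (ℕ.≤-trans l₃ N≤n)))

infixl 6 _+ᴿ_
infixl 7 _*ᴿ_

_+ᴿ_ : Op₂ ℝ
x +ᴿ y = mkℝ (λ n → seq x n ℚ.+ seq y n)
  (+-cauchy (seq x) (seq y) (cauchy x) (cauchy y))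

_*ᴿ_ : Op₂ ℝ
x *ᴿ y = mkℝ (λ n → seq x n ℚ.* seq y n)
  (*-cauchy (seq x) (seq y) (cauchy x) (cauchy y))

fromℚ : ℚ → ℝ
fromℚ q = mkℝ (λ _ → q) (λ ε → 0 , λ _ _ _ _ → ∣0∣≤ q ε)

0ᴿ 1ᴿ : ℝ
0ᴿ = fromℚ 0ℚ
1ᴿ = fromℚ 1ℚ

ℝ² : Set
ℝ² = ℝ × ℝ

+ᴿ-rawMonoid : RawMonoid 0ℓ 0ℓ
+ᴿ-rawMonoid = record { _≈_ = _≈ᴿ_ ; _∙_ = _+ᴿ_ ; ε = 0ᴿ }

ℝ²-rawMonoid : RawMonoid 0ℓ 0ℓ
ℝ²-rawMonoid = rawMonoid +ᴿ-rawMonoid +ᴿ-rawMonoid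

open RawMonoid ℝ²-rawMonoid public
  using () renaming (_≈_ to _≈ᴿ²_)

infixr 8 _·_

_·_ : ℝ → ℝ² → ℝ²
c · (x , y) = c *ᴿ x , c *ᴿ y

ℤ² : Set
ℤ² = ℤ × ℤ

O : ℤ²
O = 0ℤ , 0ℤ

infixl 6 _⊕_

_⊕_ : Op₂ ℤ²
(a , b) ⊕ (c , d) = a ℤ.+ c , b ℤ.+ d

ι : ℤ² → ℝ²
ι (a , b) = fromℚ (a ℚ./ 1) , fromℚ (b ℚ./ 1)

-- A step set is a predicate X on ℤ² with ¬ (O ∈ X).  The theorem carries
-- the latter as a hypothesis; the definitions below do not need it.

Conv : Pred ℤ² ℓ → Pred ℝ² ℓ
Conv X p = ∃[ k ] Σ (Fin k → ℝ) λ c → Σ (Fin k → ℤ²) λ A →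
    (∀ i → A i ∈ X)
  × (∀ i → 0ᴿ ≤ᴿ c i)
  × sum +ᴿ-rawMonoid c ≈ᴿ 1ᴿ
  × sum ℝ²-rawMonoid (λ i → c i · ι (A i)) ≈ᴿ² p

-- Words are lists of lattice points rather than of pairs (point, proof of
-- membership in X), so that two words are equal exactly when their letters
-- are, even if X is proof-relevant.
𝓕 : Pred ℤ² ℓ → Pred (List ℤ²) ℓ
𝓕 X = All X

α : List ℤ² → ℤ²
α = foldr _⊕_ O

data 𝓐 (X : Pred ℤ² ℓ) : Pred ℤ² ℓ where
  gen  : ∀ {A} → A ∈ X → A ∈ 𝓐 X
  unit : O ∈ 𝓐 X
  add  : ∀ {A B} → A ∈ 𝓐 X → B ∈ 𝓐 X → A ⊕ B ∈ 𝓐 X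

-- Infinitude in its positive form: infinitely many distinct elements are
-- exhibited by an injection of ℕ.
Infinite : {S : Set a} → Pred S ℓ → Set _
Infinite {S = S} P = Σ (ℕ → S) λ f → Injective _≡_ _≡_ f × (∀ n → f n ∈ P)

π[_,_]=∞ : Pred ℤ² ℓ → ℤ² → Set ℓ
π[ X , A ]=∞ = Infinite (λ w → w ∈ 𝓕 X × α w ≡ A)

IPP : Pred ℤ² ℓ → Set ℓ
IPP X = ∀ A → A ∈ 𝓐 X → π[ X , A ]=∞

⊕-assoc : ∀ A B C → (A ⊕ B) ⊕ C ≡ A ⊕ (B ⊕ C)
⊕-assoc (a , b) (c , d) (e , f) = cong₂ _,_ (ℤ.+-assoc a c e) (ℤ.+-assoc b d f)

⊕-identityˡ : ∀ A → O ⊕ A ≡ A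
⊕-identityˡ (a , b) = cong₂ _,_ (ℤ.+-identityˡ a) (ℤ.+-identityˡ b)

⊕-identityʳ : ∀ A → A ⊕ O ≡ A
⊕-identityʳ (a , b) = cong₂ _,_ (ℤ.+-identityʳ a) (ℤ.+-identityʳ b)

-- Elements are compared by their underlying lattice points only.
𝓐-monoid : Pred ℤ² ℓ → Monoid ℓ 0ℓ
𝓐-monoid X = record
  { Carrier  = Σ ℤ² (𝓐 X)
  ; _≈_      = λ A B → proj₁ A ≡ proj₁ B
  ; _∙_      = λ A B → proj₁ A ⊕ proj₁ B , add (proj₂ A) (proj₂ B)
  ; ε        = O , unit
  ; isMonoid = record
    { isSemigroup = record
      { isMagma = record
        { isEquivalence = record { refl = refl ; sym = sym ; trans = trans }
        ; ∙-cong        = cong₂ _⊕_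
        }
      ; assoc = λ A B C → ⊕-assoc (proj₁ A) (proj₁ B) (proj₁ C)
      }
    ; identity = (λ A → ⊕-identityˡ (proj₁ A)) , (λ A → ⊕-identityʳ (proj₁ A))
    }
  }

HasNonTrivialUnits : ∀ {c ℓ} → Monoid c ℓ → Set _
HasNonTrivialUnits M = ∃[ x ] Invertible _≈_ ε _∙_ x × ¬ (x ≈ ε)
  where open Monoid M

Vertex : Pred ℤ² ℓ → Set ℓ
Vertex X = Σ ℤ² (𝓐 X)

-- Only the underlying point of the target is constrained, so vertices that
-- differ in their membership proof alone have the same in-edges and
-- out-edges.
Edge : (X : Pred ℤ² ℓ) → ℤ² → Rel (Vertex X) ℓ
Edge X B A A′ = B ∈ X × proj₁ A′ ≡ proj₁ A ⊕ B

Γ : (X : Pred ℤ² ℓ) → Rel (Vertex X) ℓ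
Γ X A A′ = ∃[ B ] Edge X B A A′

HasNonTrivialCycles : {V : Set a} → Rel V ℓ → Set _
HasNonTrivialCycles _⟶_ = ∃[ A ] TransClosure _⟶_ A A

{-# OPTIONS --safe #-}

-- Each condition is equivalent to the existence of a non-empty word of sum O.
-- Only the passage from O ∈ Conv(X) to such a word is not immediate, since the
-- weights are real. By Gordan's alternative, finitely many points of X either
-- have such a word or lie in an open half plane y ∙ A > 0; the two cases are
-- told apart by integer arithmetic, adding one point at a time. In the second
-- case y ∙ A ≥ 1 on integral points, so pairing y with a convex combination
-- equal to O gives 0 ≥ 1.

module Submission where

open import Defs
open import Algebra.Definitions.RawMonoid using (sum)
open import Data.Fin.Base using (Fin; zero; suc)
open import Data.Integer.Base as ℤ using (ℤ; +_; +[1+_]; 0ℤ)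
import Data.Integer.Properties as ℤ
open import Data.Integer.Tactic.RingSolver using (solve-∀)
open import Data.List.Base
  using (List; []; _∷_; _++_; length; replicate; lookup)
open import Data.List.Properties using (length-++)
open import Data.List.Membership.Propositional.Properties using (∈-lookup)
open import Data.List.Relation.Unary.All as All using (All; []; _∷_)
import Data.List.Relation.Unary.All.Properties as All
open import Data.List.Relation.Unary.Any as Any using (Any)
open import Data.Nat.Base as ℕ using (ℕ; zero; suc; _⊔_; z≤n; s≤s)
import Data.Nat.Properties as ℕ
open import Data.Product.Base using (∃-syntax; _×_; _,_; proj₁; proj₂)
open import Data.Rational.Base as ℚ using (ℚ; 0ℚ; 1ℚ; ½; Positive; 1/_; ∣_∣)
import Data.Rational.Properties as ℚ
open import Data.Rational.Solver using (module +-*-Solver)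
open import Data.Rational.Unnormalised.Base as ℚᵘ using (mkℚᵘ; *≡*)
import Data.Rational.Unnormalised.Properties as ℚᵘ
open import Data.Sum.Base using (_⊎_; inj₁; inj₂)
open import Function.Base using (_∘_)
open import Function.Bundles using (_⇔_; mk⇔)
open import Level using (Level)
open import Relation.Binary.Construct.Closure.Transitive
  using (TransClosure; [_]; _∷_)
open import Relation.Binary.Definitions using (tri<; tri≈; tri>)
open import Relation.Binary.PropositionalEquality
open import Relation.Nullary.Decidable using (yes; no)
open import Relation.Nullary.Negation using (¬_; contradiction)
open import Relation.Unary using (Pred; _∈_)

private
  variable
    ℓ : Level
    X : Pred ℤ² ℓ

-- Lattice vectors, words and the monoid they generate

⊕-comm : ∀ A B → A ⊕ B ≡ B ⊕ A
⊕-comm (a , b) (c , d) = cong₂ _,_ (ℤ.+-comm a c) (ℤ.+-comm b d)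

⊕-identityʳ-unique : ∀ A B → A ≡ A ⊕ B → B ≡ O
⊕-identityʳ-unique (a , b) (c , d) eq =
  cong₂ _,_ (identityʳ-unique a c (sym (cong proj₁ eq)))
            (identityʳ-unique b d (sym (cong proj₂ eq)))
  where
  open import Algebra.Properties.AbelianGroup ℤ.+-0-abelianGroup
    using (identityʳ-unique)

infixr 7 _•_
infix  7 _∙_

_•_ : ℤ → ℤ² → ℤ²
m • (a , b) = m ℤ.* a , m ℤ.* b

_∙_ : ℤ² → ℤ² → ℤ
(p , q) ∙ (a , b) = p ℤ.* a ℤ.+ q ℤ.* b

α-++ : ∀ u v → α (u ++ v) ≡ α u ⊕ α v
α-++ []      v = sym (⊕-identityˡ (α v))
α-++ (A ∷ u) v = trans (cong (A ⊕_) (α-++ u v)) (sym (⊕-assoc A (α u) (α v)))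

α-replicate : ∀ n A → α (replicate n A) ≡ + n • A
α-replicate zero    (a , b) = refl
α-replicate (suc n) A@(a , b) = trans (cong (A ⊕_) (α-replicate n A))
  (cong₂ _,_ (sym (ℤ.suc-* (+ n) a)) (sym (ℤ.suc-* (+ n) b)))

𝓐⇒word : ∀ {A} → A ∈ 𝓐 X → ∃[ w ] w ∈ 𝓕 X × α w ≡ A
𝓐⇒word (gen {A} A∈X) = A ∷ [] , A∈X ∷ [] , ⊕-identityʳ A
𝓐⇒word unit          = [] , [] , refl
𝓐⇒word (add A∈𝓐 B∈𝓐) with 𝓐⇒word A∈𝓐 | 𝓐⇒word B∈𝓐
... | u , u∈𝓕 , refl | v , v∈𝓕 , refl = u ++ v , All.++⁺ u∈𝓕 v∈𝓕 , α-++ u v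

word⇒𝓐 : ∀ {w} → w ∈ 𝓕 X → α w ∈ 𝓐 X
word⇒𝓐 []          = unit
word⇒𝓐 (A∈X ∷ w∈𝓕) = add (gen A∈X) (word⇒𝓐 w∈𝓕)

-- Splitting off the first letter builds non-emptiness into the shape of the word; that letter later
-- serves as the non-trivial unit.
ZeroWord : Pred ℤ² ℓ → Set ℓ
ZeroWord X = ∃[ A ] ∃[ w ] (A ∷ w) ∈ 𝓕 X × α (A ∷ w) ≡ O

-- The coefficients become multiplicities of letters, and `0 < a` supplies the first letter. Three
-- points are enough in the plane; a relation between two is covered by a zero coefficient.
combination⇒zeroWord : ∀ {A B C} {a b c} → A ∈ X → B ∈ X → C ∈ X →
  0ℤ ℤ.< a → 0ℤ ℤ.≤ b → 0ℤ ℤ.≤ c →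
  a • A ⊕ (b • B ⊕ c • C) ≡ O → ZeroWord X
combination⇒zeroWord {A = A} {B} {C} {+[1+ k ]} {+ m} {+ n} A∈X B∈X C∈X _ _ _ eq =
  A , replicate k A ++ replicate m B ++ replicate n C
    , All.++⁺ (All.replicate⁺ (suc k) A∈X)
        (All.++⁺ (All.replicate⁺ m B∈X) (All.replicate⁺ n C∈X))
    , (begin
        α (replicate (suc k) A ++ replicate m B ++ replicate n C)
          ≡⟨ α-++ (replicate (suc k) A) _ ⟩
        α (replicate (suc k) A) ⊕ α (replicate m B ++ replicate n C)
          ≡⟨ cong₂ _⊕_ (α-replicate (suc k) A)
               (trans (α-++ (replicate m B) (replicate n C))
                 (cong₂ _⊕_ (α-replicate m B) (α-replicate n C))) ⟩
        +[1+ k ] • A ⊕ (+ m • B ⊕ + n • C)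
          ≡⟨ eq ⟩
        O ∎)
  where open ≡-Reasoning
combination⇒zeroWord {a = +[1+ _ ]} {+ _} {ℤ.-[1+ _ ]} _ _ _ _ _ () _
combination⇒zeroWord {a = +[1+ _ ]} {ℤ.-[1+ _ ]} _ _ _ _ () _ _
combination⇒zeroWord {a = + zero} _ _ _ (ℤ.+<+ ()) _ _ _
combination⇒zeroWord {a = ℤ.-[1+ _ ]} _ _ _ () _ _ _

-- Gordan's alternative in the plane

-- `rot A ∙ B` is the determinant det(A,B) and `rot⁻ A ∙ B` is det(B,A): the two vectors are
-- opposite normals to `A`.
rot : ℤ² → ℤ²
rot (a , b) = ℤ.- b , a

rot⁻ : ℤ² → ℤ²
rot⁻ (a , b) = b , ℤ.- a

Separates : ℤ² → List ℤ² → Set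
Separates y L = All (λ B → 0ℤ ℤ.< y ∙ B) L

-- By integrality `z ∙ B` is at least 1, so any `M` exceeding `∣ u ∙ B ∣` outweighs the contribution
-- of `u`. Asking for all `M` beyond a threshold lets the thresholds of the points be combined by a
-- maximum.
tilt : ∀ (z u : ℤ²) L → Separates z L →
  ∃[ N ] ∀ M → N ℕ.≤ M → Separates (+ M • z ⊕ u) L
tilt z u [] [] = 0 , λ _ _ → []
tilt z@(z₁ , z₂) u@(u₁ , u₂) (B@(b₁ , b₂) ∷ L) (z∙B>0 ∷ rest) with tilt z u L rest
... | N , h = suc ℤ.∣ u ∙ B ∣ ⊔ N , λ M le →
      positive M (ℕ.m⊔n≤o⇒m≤o (suc ℤ.∣ u ∙ B ∣) N le)
      ∷ h M (ℕ.m⊔n≤o⇒n≤o (suc ℤ.∣ u ∙ B ∣) N le)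
  where
  open ℤ.≤-Reasoning

  expand : ∀ m z₁ z₂ u₁ u₂ b₁ b₂ →
    m ℤ.* (z₁ ℤ.* b₁ ℤ.+ z₂ ℤ.* b₂) ℤ.+ (u₁ ℤ.* b₁ ℤ.+ u₂ ℤ.* b₂)
    ≡ (m ℤ.* z₁ ℤ.+ u₁) ℤ.* b₁ ℤ.+ (m ℤ.* z₂ ℤ.+ u₂) ℤ.* b₂
  expand = solve-∀

  -i≤∣i∣ : ∀ i → ℤ.- i ℤ.≤ + ℤ.∣ i ∣
  -i≤∣i∣ (+ zero)     = ℤ.≤-refl
  -i≤∣i∣ +[1+ n ]     = ℤ.-≤+
  -i≤∣i∣ ℤ.-[1+ n ]   = ℤ.≤-refl

  positive : ∀ M → suc ℤ.∣ u ∙ B ∣ ℕ.≤ M → 0ℤ ℤ.< (+ M • z ⊕ u) ∙ B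
  positive M le = begin-strict
    0ℤ                          ≡⟨ ℤ.+-inverseˡ (u ∙ B) ⟨
    ℤ.- (u ∙ B) ℤ.+ u ∙ B       ≤⟨ ℤ.+-monoˡ-≤ (u ∙ B) (-i≤∣i∣ (u ∙ B)) ⟩
    + ℤ.∣ u ∙ B ∣ ℤ.+ u ∙ B     <⟨ ℤ.+-monoˡ-< (u ∙ B) (ℤ.+<+ le) ⟩
    + M ℤ.+ u ∙ B               ≡⟨ cong (ℤ._+ u ∙ B) (ℤ.*-identityʳ (+ M)) ⟨
    + M ℤ.* ℤ.1ℤ ℤ.+ u ∙ B
      ≤⟨ ℤ.+-monoˡ-≤ (u ∙ B) (ℤ.*-monoˡ-≤-nonNeg (+ M) (ℤ.i<j⇒suc[i]≤j z∙B>0)) ⟩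
    + M ℤ.* (z ∙ B) ℤ.+ u ∙ B   ≡⟨ expand (+ M) z₁ z₂ u₁ u₂ b₁ b₂ ⟩
    (+ M • z ⊕ u) ∙ B           ∎

0<A∙A : ∀ A → A ≢ O → 0ℤ ℤ.< A ∙ A
0<A∙A (+ zero      , + zero)      A≢O = contradiction refl A≢O
0<A∙A (+ zero      , +[1+ _ ])    _   = ℤ.+<+ (s≤s z≤n)
0<A∙A (+ zero      , ℤ.-[1+ _ ])  _   = ℤ.+<+ (s≤s z≤n)
0<A∙A (+[1+ _ ]    , + zero)      _   = ℤ.+<+ (s≤s z≤n)
0<A∙A (+[1+ _ ]    , +[1+ _ ])    _   = ℤ.+<+ (s≤s z≤n)
0<A∙A (+[1+ _ ]    , ℤ.-[1+ _ ])  _   = ℤ.+<+ (s≤s z≤n)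
0<A∙A (ℤ.-[1+ _ ]  , + zero)      _   = ℤ.+<+ (s≤s z≤n)
0<A∙A (ℤ.-[1+ _ ]  , +[1+ _ ])    _   = ℤ.+<+ (s≤s z≤n)
0<A∙A (ℤ.-[1+ _ ]  , ℤ.-[1+ _ ])  _   = ℤ.+<+ (s≤s z≤n)

-- Perturb z towards A, where A lies on the line z ∙ A ≡ 0.
separates-∷ : ∀ {z A L} → A ≢ O → z ∙ A ≡ 0ℤ → Separates z L →
  ∃[ y ] Separates y (A ∷ L)
separates-∷ {z@(z₁ , z₂)} {A@(a₁ , a₂)} {L} A≢O z∙A≡0 zL with tilt z A L zL
... | N , h = + N • z ⊕ A , subst (0ℤ ℤ.<_) (sym eq) (0<A∙A A A≢O) ∷ h N ℕ.≤-refl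
  where
  expand : ∀ m z₁ z₂ a₁ a₂ →
    (m ℤ.* z₁ ℤ.+ a₁) ℤ.* a₁ ℤ.+ (m ℤ.* z₂ ℤ.+ a₂) ℤ.* a₂
    ≡ m ℤ.* (z₁ ℤ.* a₁ ℤ.+ z₂ ℤ.* a₂) ℤ.+ (a₁ ℤ.* a₁ ℤ.+ a₂ ℤ.* a₂)
  expand = solve-∀

  open ≡-Reasoning

  eq : (+ N • z ⊕ A) ∙ A ≡ A ∙ A
  eq = begin
    (+ N • z ⊕ A) ∙ A            ≡⟨ expand (+ N) z₁ z₂ a₁ a₂ ⟩
    + N ℤ.* (z ∙ A) ℤ.+ A ∙ A    ≡⟨ cong (λ t → + N ℤ.* t ℤ.+ A ∙ A) z∙A≡0 ⟩
    + N ℤ.* 0ℤ ℤ.+ A ∙ A         ≡⟨ cong (ℤ._+ A ∙ A) (ℤ.*-zeroʳ (+ N)) ⟩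
    0ℤ ℤ.+ A ∙ A                 ≡⟨ ℤ.+-identityˡ (A ∙ A) ⟩
    A ∙ A                        ∎

-- The vector `(y ∙ B) • A ⊕ (ℤ.- (y ∙ A)) • B` is det(A,B) times `rot⁻ y`, so it vanishes with the
-- determinant. `B`, repeated with coefficient 0, fills the third place.
zeroWord-collinear : ∀ {y A B} → A ∈ X → B ∈ X →
  y ∙ A ℤ.≤ 0ℤ → 0ℤ ℤ.< y ∙ B → rot A ∙ B ≡ 0ℤ → ZeroWord X
zeroWord-collinear {y = y@(y₁ , y₂)} {A@(a₁ , a₂)} {B@(b₁ , b₂)}
  A∈X B∈X yA≤0 yB>0 det≡0 =
  combination⇒zeroWord {a = y ∙ B} {b = ℤ.- (y ∙ A)} {c = 0ℤ}
    A∈X B∈X B∈X yB>0 (ℤ.neg-mono-≤ yA≤0) ℤ.≤-refl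
    (cong₂ _,_ (trans (id₁ y₁ y₂ a₁ a₂ b₁ b₂) (vanish y₂))
               (trans (id₂ y₁ y₂ a₁ a₂ b₁ b₂) (vanish (ℤ.- y₁))))
  where
  vanish : ∀ i → i ℤ.* (rot A ∙ B) ≡ 0ℤ
  vanish i = trans (cong (i ℤ.*_) det≡0) (ℤ.*-zeroʳ i)

  id₁ : ∀ y₁ y₂ a₁ a₂ b₁ b₂ →
    (y₁ ℤ.* b₁ ℤ.+ y₂ ℤ.* b₂) ℤ.* a₁
      ℤ.+ (ℤ.- (y₁ ℤ.* a₁ ℤ.+ y₂ ℤ.* a₂) ℤ.* b₁ ℤ.+ 0ℤ ℤ.* b₁)
    ≡ y₂ ℤ.* (ℤ.- a₂ ℤ.* b₁ ℤ.+ a₁ ℤ.* b₂)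
  id₁ = solve-∀

  id₂ : ∀ y₁ y₂ a₁ a₂ b₁ b₂ →
    (y₁ ℤ.* b₁ ℤ.+ y₂ ℤ.* b₂) ℤ.* a₂
      ℤ.+ (ℤ.- (y₁ ℤ.* a₁ ℤ.+ y₂ ℤ.* a₂) ℤ.* b₂ ℤ.+ 0ℤ ℤ.* b₂)
    ≡ ℤ.- y₁ ℤ.* (ℤ.- a₂ ℤ.* b₁ ℤ.+ a₁ ℤ.* b₂)
  id₂ = solve-∀

-- The coefficients come from the Plücker relation
-- det(A,B) C + det(B,C) A + det(C,A) B = O; pairing it with y shows that the
-- middle one is nonnegative.
zeroWord-spanning : ∀ {y A B C} → A ∈ X → B ∈ X → C ∈ X →
  y ∙ A ℤ.≤ 0ℤ → 0ℤ ℤ.< y ∙ B → 0ℤ ℤ.< y ∙ C →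
  0ℤ ℤ.< rot A ∙ B → 0ℤ ℤ.< rot⁻ A ∙ C → ZeroWord X
zeroWord-spanning {y = y@(y₁ , y₂)} {A@(a₁ , a₂)} {B@(b₁ , b₂)} {C@(c₁ , c₂)}
  A∈X B∈X C∈X yA≤0 yB>0 yC>0 AB>0 CA>0 =
  combination⇒zeroWord {a = rot A ∙ B} {b = rot B ∙ C} {c = rot⁻ A ∙ C}
    C∈X A∈X B∈X AB>0 (ℤ.≮⇒≥ BC≮0) (ℤ.<⇒≤ CA>0)
    (cong₂ _,_ (id₁ a₁ a₂ b₁ b₂ c₁ c₂) (id₂ a₁ a₂ b₁ b₂ c₁ c₂))
  where
  id₁ : ∀ a₁ a₂ b₁ b₂ c₁ c₂ →
    (ℤ.- a₂ ℤ.* b₁ ℤ.+ a₁ ℤ.* b₂) ℤ.* c₁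
      ℤ.+ ((ℤ.- b₂ ℤ.* c₁ ℤ.+ b₁ ℤ.* c₂) ℤ.* a₁
      ℤ.+ (a₂ ℤ.* c₁ ℤ.+ ℤ.- a₁ ℤ.* c₂) ℤ.* b₁) ≡ 0ℤ
  id₁ = solve-∀

  id₂ : ∀ a₁ a₂ b₁ b₂ c₁ c₂ →
    (ℤ.- a₂ ℤ.* b₁ ℤ.+ a₁ ℤ.* b₂) ℤ.* c₂
      ℤ.+ ((ℤ.- b₂ ℤ.* c₁ ℤ.+ b₁ ℤ.* c₂) ℤ.* a₂
      ℤ.+ (a₂ ℤ.* c₁ ℤ.+ ℤ.- a₁ ℤ.* c₂) ℤ.* b₂) ≡ 0ℤ
  id₂ = solve-∀

  pairing : ∀ y₁ y₂ a₁ a₂ b₁ b₂ c₁ c₂ →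
    (ℤ.- a₂ ℤ.* b₁ ℤ.+ a₁ ℤ.* b₂) ℤ.* (y₁ ℤ.* c₁ ℤ.+ y₂ ℤ.* c₂)
      ℤ.+ ((ℤ.- b₂ ℤ.* c₁ ℤ.+ b₁ ℤ.* c₂) ℤ.* (y₁ ℤ.* a₁ ℤ.+ y₂ ℤ.* a₂)
      ℤ.+ (a₂ ℤ.* c₁ ℤ.+ ℤ.- a₁ ℤ.* c₂) ℤ.* (y₁ ℤ.* b₁ ℤ.+ y₂ ℤ.* b₂)) ≡ 0ℤ
  pairing = solve-∀

  0<*-< : ∀ {i j} → 0ℤ ℤ.< i → 0ℤ ℤ.< j → 0ℤ ℤ.< i ℤ.* j
  0<*-< {+[1+ _ ]} {+[1+ _ ]} _ _ = ℤ.+<+ (s≤s z≤n)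
  0<*-< {+ zero}   (ℤ.+<+ ()) _
  0<*-< {+[1+ _ ]} {+ zero}   _ (ℤ.+<+ ())

  0≤*-nonPos : ∀ {i j} → i ℤ.≤ 0ℤ → j ℤ.≤ 0ℤ → 0ℤ ℤ.≤ i ℤ.* j
  0≤*-nonPos {i} {j} i≤0 j≤0 = subst (ℤ._≤ i ℤ.* j) (ℤ.*-zeroʳ i)
    (ℤ.*-monoˡ-≤-nonPos i {{ℤ.nonPositive i≤0}} j≤0)

  BC≮0 : ¬ (rot B ∙ C ℤ.< 0ℤ)
  BC≮0 BC<0 = ℤ.<-irrefl (sym (pairing y₁ y₂ a₁ a₂ b₁ b₂ c₁ c₂))
    (ℤ.+-mono-<-≤ (0<*-< AB>0 yC>0)
      (ℤ.+-mono-≤ (0≤*-nonPos (ℤ.<⇒≤ BC<0) yA≤0) (ℤ.<⇒≤ (0<*-< CA>0 yB>0))))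

-- When the old normal `y` fails at the new point `A`, only the two normals to `A` need testing. If
-- one of them separates `L`, tilting it towards `A` separates `A ∷ L`. If both fail, the points of
-- `L` at which they fail lie on either side of the line through `A`, and together with `A` they
-- give a relation.
separate-or-zeroWord : ¬ (O ∈ X) → ∀ {L} → All X L →
  ZeroWord X ⊎ ∃[ y ] Separates y L
separate-or-zeroWord O∉X [] = inj₂ (O , [])
separate-or-zeroWord {X = X} O∉X {A@(a₁ , a₂) ∷ L} (A∈X ∷ L⊆X)
  with separate-or-zeroWord O∉X L⊆X
... | inj₁ word = inj₁ word
... | inj₂ (y , yL) = extend (sign y A)
  where
  sign : ∀ z B → 0ℤ ℤ.< z ∙ B ⊎ z ∙ B ℤ.≤ 0ℤ
  sign z B with 0ℤ ℤ.<? z ∙ B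
  ... | yes pos = inj₁ pos
  ... | no  neg = inj₂ (ℤ.≮⇒≥ neg)

  A≢O : A ≢ O
  A≢O A≡O = O∉X (subst X A≡O A∈X)

  rot∙A : ∀ a₁ a₂ → ℤ.- a₂ ℤ.* a₁ ℤ.+ a₁ ℤ.* a₂ ≡ 0ℤ
  rot∙A = solve-∀

  rot⁻∙A : ∀ a₁ a₂ → a₂ ℤ.* a₁ ℤ.+ ℤ.- a₁ ℤ.* a₂ ≡ 0ℤ
  rot⁻∙A = solve-∀

  rot⁻∙ : ∀ a₁ a₂ b₁ b₂ →
    ℤ.- (a₂ ℤ.* b₁ ℤ.+ ℤ.- a₁ ℤ.* b₂) ≡ ℤ.- a₂ ℤ.* b₁ ℤ.+ a₁ ℤ.* b₂
  rot⁻∙ = solve-∀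

  rot∙ : ∀ a₁ a₂ b₁ b₂ →
    ℤ.- (ℤ.- a₂ ℤ.* b₁ ℤ.+ a₁ ℤ.* b₂) ≡ a₂ ℤ.* b₁ ℤ.+ ℤ.- a₁ ℤ.* b₂
  rot∙ = solve-∀

  -- A witness on the line through `A` already gives a relation with `A` alone; otherwise `B` and
  -- `C` lie strictly on opposite sides of that line.
  both-sides : y ∙ A ℤ.≤ 0ℤ →
    Any (λ B → rot A ∙ B ℤ.≤ 0ℤ) L → Any (λ C → rot⁻ A ∙ C ℤ.≤ 0ℤ) L → ZeroWord X
  both-sides yA≤0 right left
    with Any.lookup right | Any.lookup left
       | All.lookupAny (All.zip (L⊆X , yL)) right
       | All.lookupAny (All.zip (L⊆X , yL)) left
  ... | B@(b₁ , b₂) | C@(c₁ , c₂) | (B∈X , yB>0) , AB≤0 | (C∈X , yC>0) , CA≤0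
    with ℤ.<-cmp (rot A ∙ B) 0ℤ | ℤ.<-cmp (rot⁻ A ∙ C) 0ℤ
  ... | tri≈ _ AB≡0 _ | _ = zeroWord-collinear {y = y} A∈X B∈X yA≤0 yB>0 AB≡0
  ... | tri> _ _ AB>0 | _ = contradiction AB>0 (ℤ.≤⇒≯ AB≤0)
  ... | tri< _ _ _ | tri≈ _ CA≡0 _ = zeroWord-collinear {y = y} A∈X C∈X yA≤0 yC>0
        (trans (sym (rot⁻∙ a₁ a₂ c₁ c₂)) (cong ℤ.-_ CA≡0))
  ... | tri< _ _ _ | tri> _ _ CA>0 = contradiction CA>0 (ℤ.≤⇒≯ CA≤0)
  -- Here det(A,C) and det(B,A) are positive, so `B` and `C` trade the places they have in
  -- `zeroWord-spanning`.
  ... | tri< AB<0 _ _ | tri< CA<0 _ _ =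
        zeroWord-spanning {y = y} A∈X C∈X B∈X yA≤0 yC>0 yB>0
          (subst (0ℤ ℤ.<_) (rot⁻∙ a₁ a₂ c₁ c₂) (ℤ.neg-mono-< CA<0))
          (subst (0ℤ ℤ.<_) (rot∙ a₁ a₂ b₁ b₂) (ℤ.neg-mono-< AB<0))

  extend : 0ℤ ℤ.< y ∙ A ⊎ y ∙ A ℤ.≤ 0ℤ →
    ZeroWord X ⊎ ∃[ y ] Separates y (A ∷ L)
  extend (inj₁ yA>0) = inj₂ (y , yA>0 ∷ yL)
  extend (inj₂ yA≤0) with All.decide (sign (rot A)) L | All.decide (sign (rot⁻ A)) L
  ... | inj₁ rotL  | _          = inj₂ (separates-∷ {rot A} A≢O (rot∙A a₁ a₂) rotL)
  ... | inj₂ _     | inj₁ rot⁻L = inj₂ (separates-∷ {rot⁻ A} A≢O (rot⁻∙A a₁ a₂) rot⁻L)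
  ... | inj₂ right | inj₂ left  = inj₁ (both-sides yA≤0 right left)

-- Order properties of ℝ

≤ᴿ-trans : ∀ {x y z} → x ≤ᴿ y → y ≤ᴿ z → x ≤ᴿ z
≤ᴿ-trans {x} {y} {z} x≤y y≤z ε
  with x≤y (½ ℚ.* ε) {{ℚ.pos*pos⇒pos ½ ε}} | y≤z (½ ℚ.* ε) {{ℚ.pos*pos⇒pos ½ ε}}
... | N₁ , h₁ | N₂ , h₂ = N₁ ⊔ N₂ , λ n le → begin
  seq x n
    ≤⟨ h₁ n (ℕ.m⊔n≤o⇒m≤o N₁ N₂ le) ⟩
  seq y n ℚ.+ ½ ℚ.* ε
    ≤⟨ ℚ.+-monoˡ-≤ (½ ℚ.* ε) (h₂ n (ℕ.m⊔n≤o⇒n≤o N₁ N₂ le)) ⟩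
  seq z n ℚ.+ ½ ℚ.* ε ℚ.+ ½ ℚ.* ε
    ≡⟨ halves (seq z n) ε ⟩
  seq z n ℚ.+ ε ∎
  where
  open ℚ.≤-Reasoning
  open +-*-Solver
  halves : ∀ p e → p ℚ.+ ½ ℚ.* e ℚ.+ ½ ℚ.* e ≡ p ℚ.+ e
  halves = solve 2 (λ p e → p :+ con ½ :* e :+ con ½ :* e := p :+ e) refl

+ᴿ-mono-≤ᴿ : ∀ {x y u v} → x ≤ᴿ y → u ≤ᴿ v → x +ᴿ u ≤ᴿ y +ᴿ v
+ᴿ-mono-≤ᴿ {x} {y} {u} {v} x≤y u≤v ε
  with x≤y (½ ℚ.* ε) {{ℚ.pos*pos⇒pos ½ ε}} | u≤v (½ ℚ.* ε) {{ℚ.pos*pos⇒pos ½ ε}}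
... | N₁ , h₁ | N₂ , h₂ = N₁ ⊔ N₂ , λ n le → begin
  seq x n ℚ.+ seq u n
    ≤⟨ ℚ.+-mono-≤ (h₁ n (ℕ.m⊔n≤o⇒m≤o N₁ N₂ le)) (h₂ n (ℕ.m⊔n≤o⇒n≤o N₁ N₂ le)) ⟩
  (seq y n ℚ.+ ½ ℚ.* ε) ℚ.+ (seq v n ℚ.+ ½ ℚ.* ε)
    ≡⟨ halves (seq y n) (seq v n) ε ⟩
  seq y n ℚ.+ seq v n ℚ.+ ε ∎
  where
  open ℚ.≤-Reasoning
  open +-*-Solver
  halves : ∀ p q e → (p ℚ.+ ½ ℚ.* e) ℚ.+ (q ℚ.+ ½ ℚ.* e) ≡ p ℚ.+ q ℚ.+ e
  halves = solve 3 (λ p q e →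
    (p :+ con ½ :* e) :+ (q :+ con ½ :* e) := p :+ q :+ e) refl

p≤p+ε : ∀ p ε → .{{Positive ε}} → p ℚ.≤ p ℚ.+ ε
p≤p+ε p ε = subst (ℚ._≤ p ℚ.+ ε) (ℚ.+-identityʳ p)
  (ℚ.+-monoʳ-≤ p (ℚ.<⇒≤ (ℚ.positive⁻¹ ε)))

-- Real sums and products are formed termwise, so this carries ring identities of ℚ over to ℝ.
≗⇒≤ᴿ : ∀ {x y} → seq x ≗ seq y → x ≤ᴿ y
≗⇒≤ᴿ {x} {y} x≗y ε = 0 , λ n _ →
  subst (ℚ._≤ seq y n ℚ.+ ε) (sym (x≗y n)) (p≤p+ε (seq y n) ε)

≗⇒≈ᴿ : ∀ {x y} → seq x ≗ seq y → x ≈ᴿ y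
≗⇒≈ᴿ {x} {y} x≗y ε = 0 , λ n _ →
  subst (λ q → ∣ q ∣ ℚ.≤ ε)
    (sym (trans (cong (ℚ._- seq y n) (x≗y n)) (ℚ.+-inverseʳ (seq y n))))
    (ℚ.<⇒≤ (ℚ.positive⁻¹ ε))

≈ᴿ-sym : ∀ {x y} → x ≈ᴿ y → y ≈ᴿ x
≈ᴿ-sym {x} {y} x≈y ε with x≈y ε
... | N , h = N , λ n le → subst (ℚ._≤ ε) (swap (seq x n) (seq y n)) (h n le)
  where
  swap : ∀ p q → ∣ p ℚ.- q ∣ ≡ ∣ q ℚ.- p ∣
  swap p q = trans (sym (ℚ.∣-p∣≡∣p∣ (p ℚ.- q)))
    (cong ∣_∣ (solve 2 (λ p q → :- (p :- q) := q :- p) refl p q))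
    where open +-*-Solver

p≤∣p∣ : ∀ p → p ℚ.≤ ∣ p ∣
p≤∣p∣ p with ℚ.≤-total 0ℚ p
... | inj₁ 0≤p = ℚ.≤-reflexive (sym (ℚ.0≤p⇒∣p∣≡p 0≤p))
... | inj₂ p≤0 = ℚ.≤-trans p≤0 (ℚ.0≤∣p∣ p)

≈ᴿ⇒≤ᴿ : ∀ {x y} → x ≈ᴿ y → x ≤ᴿ y
≈ᴿ⇒≤ᴿ {x} {y} x≈y ε with x≈y ε
... | N , h = N , λ n le → begin
  seq x n
    ≡⟨ solve 2 (λ p q → p := q :+ (p :- q)) refl (seq x n) (seq y n) ⟩
  seq y n ℚ.+ (seq x n ℚ.- seq y n)
    ≤⟨ ℚ.+-monoʳ-≤ (seq y n) (ℚ.≤-trans (p≤∣p∣ (seq x n ℚ.- seq y n)) (h n le)) ⟩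
  seq y n ℚ.+ ε ∎
  where
  open ℚ.≤-Reasoning
  open +-*-Solver

1≰ᴿ0 : ¬ (1ᴿ ≤ᴿ 0ᴿ)
-- Any slack below 1 exposes the gap between the constant sequences.
1≰ᴿ0 1≤0 with 1≤0 ½
... | N , h with h N ℕ.≤-refl
...   | ℚ.*≤* (ℤ.+≤+ (s≤s ()))

-- Here δ is ε / M. It absorbs a factor `M` in error estimates and, with ε = 1, yields the common
-- weight 1/k for a word of length k.
pos-divide : ∀ M ε → .{{Positive M}} → .{{Positive ε}} →
  ∃[ δ ] Positive δ × M ℚ.* δ ≡ ε
pos-divide M ε = 1/M ℚ.* ε , ℚ.pos*pos⇒pos 1/M {{ℚ.1/pos⇒pos M}} ε , (begin
  M ℚ.* (1/M ℚ.* ε)  ≡⟨ ℚ.*-assoc M 1/M ε ⟨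
  M ℚ.* 1/M ℚ.* ε    ≡⟨ cong (ℚ._* ε) (ℚ.*-inverseʳ M {{ℚ.pos⇒nonZero M}}) ⟩
  1ℚ ℚ.* ε           ≡⟨ ℚ.*-identityˡ ε ⟩
  ε                  ∎)
  where
  open ≡-Reasoning
  1/M : ℚ
  1/M = (1/ M) {{ℚ.pos⇒nonZero M}}

*ᴿ-≈0⇒≤0 : ∀ q {x} → x ≈ᴿ 0ᴿ → fromℚ q *ᴿ x ≤ᴿ 0ᴿ
*ᴿ-≈0⇒≤0 q {x} x≈0 ε
  -- Adding 1 keeps the divisor positive even for `q` equal to 0.
  with pos-divide (∣ q ∣ ℚ.+ 1ℚ) ε {{ℚ.nonNeg+pos⇒pos ∣ q ∣ {{ℚ.∣-∣-nonNeg q}} 1ℚ}}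
... | δ , δ>0 , Mδ≡ε with x≈0 δ {{δ>0}}
...   | N , h = N , λ n le → begin
  q ℚ.* seq x n
    ≤⟨ p≤∣p∣ (q ℚ.* seq x n) ⟩
  ∣ q ℚ.* seq x n ∣
    ≡⟨ ℚ.∣p*q∣≡∣p∣*∣q∣ q (seq x n) ⟩
  ∣ q ∣ ℚ.* ∣ seq x n ∣
    ≤⟨ ℚ.*-monoˡ-≤-nonNeg ∣ q ∣ {{ℚ.∣-∣-nonNeg q}}
         (subst (λ t → ∣ t ∣ ℚ.≤ δ) (ℚ.+-identityʳ (seq x n)) (h n le)) ⟩
  ∣ q ∣ ℚ.* δ
    ≤⟨ ℚ.*-monoʳ-≤-nonNeg δ {{ℚ.pos⇒nonNeg δ {{δ>0}}}} (p≤p+ε ∣ q ∣ 1ℚ) ⟩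
  (∣ q ∣ ℚ.+ 1ℚ) ℚ.* δ
    ≡⟨ Mδ≡ε ⟩
  ε
    ≡⟨ ℚ.+-identityˡ ε ⟨
  0ℚ ℚ.+ ε ∎
  where open ℚ.≤-Reasoning

-- The terms of a nonnegative real may be negative, but eventually they are at least -δ. Shifting by
-- δ before multiplying by `r` costs `r * δ`, which is ε for δ = ε / r.
x≤ᴿx*r : ∀ {r x} → 1ℚ ℚ.≤ r → 0ᴿ ≤ᴿ x → x ≤ᴿ x *ᴿ fromℚ r
x≤ᴿx*r {r} {x} 1≤r 0≤x ε
  with pos-divide r ε {{ℚ.positive (ℚ.<-≤-trans (ℚ.positive⁻¹ 1ℚ) 1≤r)}}
... | δ , δ>0 , rδ≡ε with 0≤x δ {{δ>0}}
...   | N , h = N , λ n le → begin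
  seq x n
    ≤⟨ p≤p+ε (seq x n) δ {{δ>0}} ⟩
  seq x n ℚ.+ δ
    ≡⟨ ℚ.*-identityʳ (seq x n ℚ.+ δ) ⟨
  (seq x n ℚ.+ δ) ℚ.* 1ℚ
    ≤⟨ ℚ.*-monoˡ-≤-nonNeg (seq x n ℚ.+ δ) {{ℚ.nonNegative (h n le)}} 1≤r ⟩
  (seq x n ℚ.+ δ) ℚ.* r
    ≡⟨ solve 3 (λ x d r → (x :+ d) :* r := x :* r :+ r :* d) refl (seq x n) δ r ⟩
  seq x n ℚ.* r ℚ.+ r ℚ.* δ
    ≡⟨ cong (seq x n ℚ.* r ℚ.+_) rδ≡ε ⟩
  seq x n ℚ.* r ℚ.+ ε ∎
  where
  open ℚ.≤-Reasoning
  open +-*-Solver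

-- The embedding of ℤ into ℚ

toℚ : ℤ → ℚ
toℚ i = i ℚ./ 1

-- Normalisation to lowest terms blocks computation in ℚ; among unnormalised fractions the claim is
-- a cross-multiplied identity of integers.
toℚ-+ : ∀ i j → toℚ (i ℤ.+ j) ≡ toℚ i ℚ.+ toℚ j
toℚ-+ i j = ℚ.toℚᵘ-injective (begin
  ℚ.toℚᵘ (toℚ (i ℤ.+ j))               ≈⟨ ℚ.toℚᵘ-fromℚᵘ (mkℚᵘ (i ℤ.+ j) 0) ⟩
  mkℚᵘ (i ℤ.+ j) 0                     ≈⟨ *≡* (numerators i j) ⟩
  mkℚᵘ i 0 ℚᵘ.+ mkℚᵘ j 0
    ≈⟨ ℚᵘ.+-cong (ℚ.toℚᵘ-fromℚᵘ (mkℚᵘ i 0)) (ℚ.toℚᵘ-fromℚᵘ (mkℚᵘ j 0)) ⟨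
  ℚ.toℚᵘ (toℚ i) ℚᵘ.+ ℚ.toℚᵘ (toℚ j)   ≈⟨ ℚ.toℚᵘ-homo-+ (toℚ i) (toℚ j) ⟨
  ℚ.toℚᵘ (toℚ i ℚ.+ toℚ j)             ∎)
  where
  open ℚᵘ.≃-Reasoning
  numerators : ∀ i j → (i ℤ.+ j) ℤ.* + 1 ≡ (i ℤ.* + 1 ℤ.+ j ℤ.* + 1) ℤ.* + 1
  numerators = solve-∀

toℚ-* : ∀ i j → toℚ (i ℤ.* j) ≡ toℚ i ℚ.* toℚ j
toℚ-* i j = ℚ.toℚᵘ-injective (begin
  ℚ.toℚᵘ (toℚ (i ℤ.* j))               ≈⟨ ℚ.toℚᵘ-fromℚᵘ (mkℚᵘ (i ℤ.* j) 0) ⟩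
  mkℚᵘ i 0 ℚᵘ.* mkℚᵘ j 0
    ≈⟨ ℚᵘ.*-cong (ℚ.toℚᵘ-fromℚᵘ (mkℚᵘ i 0)) (ℚ.toℚᵘ-fromℚᵘ (mkℚᵘ j 0)) ⟨
  ℚ.toℚᵘ (toℚ i) ℚᵘ.* ℚ.toℚᵘ (toℚ j)   ≈⟨ ℚ.toℚᵘ-homo-* (toℚ i) (toℚ j) ⟨
  ℚ.toℚᵘ (toℚ i ℚ.* toℚ j)             ∎)
  where open ℚᵘ.≃-Reasoning

-- Discreteness of ℤ enters here: the bound 1 is the same for all points, so it survives summation
-- with real weights.
1≤toℚ : ∀ {i} → 0ℤ ℤ.< i → 1ℚ ℚ.≤ toℚ i
1≤toℚ {i} i>0 = ℚ.toℚᵘ-cancel-≤ (ℚᵘ.≤-respʳ-≃ (ℚᵘ.≃-sym (ℚ.toℚᵘ-fromℚᵘ (mkℚᵘ i 0)))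
  (ℚᵘ.*≤* (ℤ.*-monoʳ-≤-nonNeg (+ 1) (ℤ.i<j⇒suc[i]≤j i>0))))

-- Convex combinations and words of sum O

-- Each `y ∙ A i` is at least 1, so each weight is at most its product with `y ∙ A i`. Summing these
-- products gives the functional `y` evaluated at the combination.
weights≤functional : ∀ y {k} (c : Fin k → ℝ) (A : Fin k → ℤ²) →
  (∀ i → 0ᴿ ≤ᴿ c i) → (∀ i → 0ℤ ℤ.< y ∙ A i) →
  let s₁ , s₂ = sum ℝ²-rawMonoid (λ i → c i · ι (A i)) in
  sum +ᴿ-rawMonoid c ≤ᴿ fromℚ (toℚ (proj₁ y)) *ᴿ s₁ +ᴿ fromℚ (toℚ (proj₂ y)) *ᴿ s₂
weights≤functional y@(p , q) {zero} c A _ _ = ≗⇒≤ᴿ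
  {0ᴿ} {fromℚ (toℚ p) *ᴿ 0ᴿ +ᴿ fromℚ (toℚ q) *ᴿ 0ᴿ}
  λ _ → sym (cong₂ ℚ._+_ (ℚ.*-zeroʳ (toℚ p)) (ℚ.*-zeroʳ (toℚ q)))
weights≤functional y@(p , q) {suc k} c A c≥0 yA>0 =
  ≤ᴿ-trans {c zero +ᴿ sum +ᴿ-rawMonoid (c ∘ suc)}
    {c zero *ᴿ fromℚ (toℚ (y ∙ A zero)) +ᴿ (fromℚ (toℚ p) *ᴿ s₁ +ᴿ fromℚ (toℚ q) *ᴿ s₂)}
    {fromℚ (toℚ p) *ᴿ (c zero *ᴿ fromℚ (toℚ a) +ᴿ s₁)
      +ᴿ fromℚ (toℚ q) *ᴿ (c zero *ᴿ fromℚ (toℚ b) +ᴿ s₂)}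
    (+ᴿ-mono-≤ᴿ {c zero} {c zero *ᴿ fromℚ (toℚ (y ∙ A zero))}
      {sum +ᴿ-rawMonoid (c ∘ suc)} {fromℚ (toℚ p) *ᴿ s₁ +ᴿ fromℚ (toℚ q) *ᴿ s₂}
      (x≤ᴿx*r {toℚ (y ∙ A zero)} {c zero} (1≤toℚ (yA>0 zero)) (c≥0 zero))
      (weights≤functional y (c ∘ suc) (A ∘ suc) (c≥0 ∘ suc) (yA>0 ∘ suc)))
    -- Linearity of `y`, as an identity of rationals at every index.
    (≗⇒≤ᴿ
      {c zero *ᴿ fromℚ (toℚ (y ∙ A zero)) +ᴿ (fromℚ (toℚ p) *ᴿ s₁ +ᴿ fromℚ (toℚ q) *ᴿ s₂)}
      {fromℚ (toℚ p) *ᴿ (c zero *ᴿ fromℚ (toℚ a) +ᴿ s₁)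
        +ᴿ fromℚ (toℚ q) *ᴿ (c zero *ᴿ fromℚ (toℚ b) +ᴿ s₂)} λ n → trans
      (cong (λ t → seq (c zero) n ℚ.* t ℚ.+ (toℚ p ℚ.* seq s₁ n ℚ.+ toℚ q ℚ.* seq s₂ n))
        (trans (toℚ-+ (p ℤ.* a) (q ℤ.* b)) (cong₂ ℚ._+_ (toℚ-* p a) (toℚ-* q b))))
      (regroup (seq (c zero) n) (toℚ p) (toℚ q) (toℚ a) (toℚ b) (seq s₁ n) (seq s₂ n)))
  where
  a = proj₁ (A zero)
  b = proj₂ (A zero)
  s = sum ℝ²-rawMonoid (λ i → c (suc i) · ι (A (suc i)))
  s₁ = proj₁ s
  s₂ = proj₂ s
  open +-*-Solver
  regroup : ∀ c p q a b s t →
    c ℚ.* (p ℚ.* a ℚ.+ q ℚ.* b) ℚ.+ (p ℚ.* s ℚ.+ q ℚ.* t)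
    ≡ p ℚ.* (c ℚ.* a ℚ.+ s) ℚ.+ q ℚ.* (c ℚ.* b ℚ.+ t)
  regroup = solve 7 (λ c p q a b s t →
    c :* (p :* a :+ q :* b) :+ (p :* s :+ q :* t)
    := p :* (c :* a :+ s) :+ q :* (c :* b :+ t)) refl

-- The alternative is applied only to the finitely many points of the combination, and it is decided
-- on the lattice points, so no real weights are ever compared to find the word.
conv⇒zeroWord : ¬ (O ∈ X) → ι O ∈ Conv X → ZeroWord X
conv⇒zeroWord O∉X (k , c , A , A∈X , c≥0 , Σc≈1 , Σ₁≈0 , Σ₂≈0)
  with separate-or-zeroWord O∉X (All.tabulate⁺ A∈X)
... | inj₁ word = word
... | inj₂ (y@(p , q) , yA) = contradiction 1≤0 1≰ᴿ0
  where
  s = sum ℝ²-rawMonoid (λ i → c i · ι (A i))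
  ps₁ = fromℚ (toℚ p) *ᴿ proj₁ s
  qs₂ = fromℚ (toℚ q) *ᴿ proj₂ s

  1≤0 : 1ᴿ ≤ᴿ 0ᴿ
  1≤0 = ≤ᴿ-trans {1ᴿ} {sum +ᴿ-rawMonoid c} {0ᴿ}
    (≈ᴿ⇒≤ᴿ {1ᴿ} {sum +ᴿ-rawMonoid c} (≈ᴿ-sym {sum +ᴿ-rawMonoid c} {1ᴿ} Σc≈1))
    (≤ᴿ-trans {sum +ᴿ-rawMonoid c} {ps₁ +ᴿ qs₂} {0ᴿ}
      (weights≤functional y c A c≥0 (All.tabulate⁻ yA))
      (+ᴿ-mono-≤ᴿ {ps₁} {0ᴿ} {qs₂} {0ᴿ}
        (*ᴿ-≈0⇒≤0 (toℚ p) {proj₁ s} Σ₁≈0) (*ᴿ-≈0⇒≤0 (toℚ q) {proj₂ s} Σ₂≈0)))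

toℚ-suc : ∀ n → toℚ +[1+ n ] ≡ 1ℚ ℚ.+ toℚ (+ n)
toℚ-suc n = trans (cong toℚ {+[1+ n ]} {+ 1 ℤ.+ + n} refl) (toℚ-+ (+ 1) (+ n))

sum-const : ∀ q k n → seq (sum +ᴿ-rawMonoid {k} (λ _ → fromℚ q)) n ≡ toℚ (+ k) ℚ.* q
sum-const q zero    n = sym (ℚ.*-zeroˡ q)
sum-const q (suc k) n = trans (cong (q ℚ.+_) (sum-const q k n))
  (trans (factor q (toℚ (+ k))) (cong (ℚ._* q) (sym (toℚ-suc k))))
  where
  factor : ∀ q p → q ℚ.+ p ℚ.* q ≡ (1ℚ ℚ.+ p) ℚ.* q
  factor q p = trans (cong (ℚ._+ p ℚ.* q) (sym (ℚ.*-identityˡ q)))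
    (sym (ℚ.*-distribʳ-+ q 1ℚ p))

sum-proj₁ : ∀ {k} (t : Fin k → ℝ²) n →
  seq (proj₁ (sum ℝ²-rawMonoid t)) n ≡ sum ℚ.+-0-rawMonoid (λ i → seq (proj₁ (t i)) n)
sum-proj₁ {zero}  t n = refl
sum-proj₁ {suc k} t n = cong (seq (proj₁ (t zero)) n ℚ.+_) (sum-proj₁ (t ∘ suc) n)

sum-proj₂ : ∀ {k} (t : Fin k → ℝ²) n →
  seq (proj₂ (sum ℝ²-rawMonoid t)) n ≡ sum ℚ.+-0-rawMonoid (λ i → seq (proj₂ (t i)) n)
sum-proj₂ {zero}  t n = refl
sum-proj₂ {suc k} t n = cong (seq (proj₂ (t zero)) n ℚ.+_) (sum-proj₂ (t ∘ suc) n)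

-- Used with `h` a coordinate multiplied by the common weight `q`, to evaluate the combination
-- through the sum of the word.
sum-lookup : ∀ (h : ℤ² → ℚ) → 0ℚ ≡ h O → (∀ A B → h A ℚ.+ h B ≡ h (A ⊕ B)) →
  ∀ w → sum ℚ.+-0-rawMonoid (λ i → h (lookup w i)) ≡ h (α w)
sum-lookup h h-O h-⊕ []      = h-O
sum-lookup h h-O h-⊕ (A ∷ w) =
  trans (cong (h A ℚ.+_) (sum-lookup h h-O h-⊕ w)) (h-⊕ A (α w))

*-additive : ∀ q i j → q ℚ.* toℚ i ℚ.+ q ℚ.* toℚ j ≡ q ℚ.* toℚ (i ℤ.+ j)
*-additive q i j = trans (sym (ℚ.*-distribˡ-+ q (toℚ i) (toℚ j)))
  (cong (q ℚ.*_) (sym (toℚ-+ i j)))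

-- A word of sum O is its own convex combination: `Conv` takes indexed families, so repeated letters
-- stay separate entries of weight `q`.
equal-weights⇒conv : ∀ q → Positive q → ∀ w → w ∈ 𝓕 X →
  toℚ (+ length w) ℚ.* q ≡ 1ℚ → α w ≡ O → ι O ∈ Conv X
equal-weights⇒conv q q>0 w w∈𝓕 kq≡1 αw≡O =
  length w , (λ _ → fromℚ q) , lookup w
    , (λ i → All.lookup w∈𝓕 (∈-lookup i))
    , (λ _ ε → 0 , λ _ _ → ℚ.≤-trans (ℚ.<⇒≤ (ℚ.positive⁻¹ q {{q>0}})) (p≤p+ε q ε))
    , ≗⇒≈ᴿ {sum +ᴿ-rawMonoid {length w} (λ _ → fromℚ q)} {1ᴿ}
        (λ n → trans (sum-const q (length w) n) kq≡1)
    , ≗⇒≈ᴿ {proj₁ s} {0ᴿ} (λ n → trans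
        (sum-proj₁ (λ i → fromℚ q · ι (lookup w i)) n)
        (trans (sum-lookup (λ A → q ℚ.* toℚ (proj₁ A)) (sym (ℚ.*-zeroʳ q))
                 (λ A B → *-additive q (proj₁ A) (proj₁ B)) w)
          (vanish (cong proj₁ αw≡O))))
    , ≗⇒≈ᴿ {proj₂ s} {0ᴿ} (λ n → trans
        (sum-proj₂ (λ i → fromℚ q · ι (lookup w i)) n)
        (trans (sum-lookup (λ A → q ℚ.* toℚ (proj₂ A)) (sym (ℚ.*-zeroʳ q))
                 (λ A B → *-additive q (proj₂ A) (proj₂ B)) w)
          (vanish (cong proj₂ αw≡O))))
  where
  s = sum ℝ²-rawMonoid (λ i → fromℚ q · ι (lookup w i))

  vanish : ∀ {i} → i ≡ 0ℤ → q ℚ.* toℚ i ≡ 0ℚ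
  vanish i≡0 = trans (cong (λ i → q ℚ.* toℚ i) i≡0) (ℚ.*-zeroʳ q)

zeroWord⇒conv : ZeroWord X → ι O ∈ Conv X
zeroWord⇒conv (A , w , Aw∈𝓕 , αAw≡O) =
  let q , q>0 , kq≡1 = pos-divide (toℚ +[1+ length w ]) 1ℚ {{k>0}}
  in equal-weights⇒conv q q>0 (A ∷ w) Aw∈𝓕 kq≡1 αAw≡O
  where
  k>0 : Positive (toℚ +[1+ length w ])
  k>0 = ℚ.positive
    (ℚ.<-≤-trans (ℚ.positive⁻¹ 1ℚ) (1≤toℚ {+[1+ length w ]} (ℤ.+<+ (s≤s z≤n))))

-- Paths, units and cycles

power : List ℤ² → ℕ → List ℤ²
power u zero    = []
power u (suc n) = u ++ power u n

power-𝓕 : ∀ {u} → u ∈ 𝓕 X → ∀ n → power u n ∈ 𝓕 X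
power-𝓕 u∈𝓕 zero    = []
power-𝓕 u∈𝓕 (suc n) = All.++⁺ u∈𝓕 (power-𝓕 u∈𝓕 n)

α-power : ∀ {u} → α u ≡ O → ∀ n → α (power u n) ≡ O
α-power         αu≡O zero    = refl
α-power {u = u} αu≡O (suc n) =
  trans (α-++ u (power u n)) (cong₂ _⊕_ αu≡O (α-power αu≡O n))

length-power : ∀ u n → length (power u n) ≡ n ℕ.* length u
length-power u zero    = refl
length-power u (suc n) =
  trans (length-++ u) (cong (length u ℕ.+_) (length-power u n))

-- Powers of the zero word are put in front of one word for `B`. Its length is positive, so the
-- lengths of the resulting words recover the exponent.
zeroWord⇒IPP : ZeroWord X → IPP X
zeroWord⇒IPP (A , w , Aw∈𝓕 , αAw≡O) B B∈𝓐 with 𝓐⇒word B∈𝓐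
... | v , v∈𝓕 , αv≡B =
    (λ n → power (A ∷ w) n ++ v)
  , (λ {m} {n} eq → ℕ.*-cancelʳ-≡ m n (suc (length w))
      (ℕ.+-cancelʳ-≡ (length v) _ _
        (trans (sym (length-f m)) (trans (cong length eq) (length-f n)))))
  , λ n → All.++⁺ (power-𝓕 Aw∈𝓕 n) v∈𝓕
        , trans (α-++ (power (A ∷ w) n) v)
            (trans (cong₂ _⊕_ (α-power αAw≡O n) αv≡B) (⊕-identityˡ B))
  where
  length-f : ∀ n →
    length (power (A ∷ w) n ++ v) ≡ n ℕ.* suc (length w) ℕ.+ length v
  length-f n = trans (length-++ (power (A ∷ w) n))
    (cong (ℕ._+ length v) (length-power (A ∷ w) n))

-- Of two distinct words of sum O, at most one is empty.
IPP⇒zeroWord : IPP X → ZeroWord X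
IPP⇒zeroWord ipp with ipp O unit
... | f , f-injective , f-zero
  with f 0 in f0≡ | f-zero 0 | f 1 in f1≡ | f-zero 1
... | A ∷ w | Aw∈𝓕 , αAw≡O | _     | _              = A , w , Aw∈𝓕 , αAw≡O
... | []    | _            | A ∷ w | Aw∈𝓕 , αAw≡O   = A , w , Aw∈𝓕 , αAw≡O
... | []    | _            | []    | _              =
  contradiction (f-injective (trans f0≡ (sym f1≡))) λ ()

-- The first letter is the unit: the rest of the word sums to its inverse.
zeroWord⇒units : ¬ (O ∈ X) → ZeroWord X → HasNonTrivialUnits (𝓐-monoid X)
zeroWord⇒units {X = X} O∉X (A , w , A∈X ∷ w∈𝓕 , αAw≡O) =
    (A , gen A∈X)
  , ((α w , word⇒𝓐 w∈𝓕) , trans (⊕-comm (α w) A) αAw≡O , αAw≡O)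
  , λ A≡O → O∉X (subst X A≡O A∈X)

-- A word for the unit followed by one for its inverse; the first is non-empty because the unit is
-- not O.
units⇒zeroWord : HasNonTrivialUnits (𝓐-monoid X) → ZeroWord X
units⇒zeroWord ((A , A∈𝓐) , ((B , B∈𝓐) , _ , A⊕B≡O) , A≢O)
  with 𝓐⇒word A∈𝓐 | 𝓐⇒word B∈𝓐
... | []    , _    , O≡A  | _              = contradiction (sym O≡A) A≢O
... | C ∷ u , u∈𝓕 , refl | v , v∈𝓕 , refl =
  C , u ++ v , All.++⁺ u∈𝓕 v∈𝓕 , trans (α-++ (C ∷ u) v) A⊕B≡O

-- Fixing only the lattice point of `v` lets the path end at any membership proof, so that a zero
-- word closes up at `(O , unit)` itself.
word⇒path : ∀ {A w} → (A ∷ w) ∈ 𝓕 X → (u v : Vertex X) →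
  proj₁ v ≡ proj₁ u ⊕ α (A ∷ w) → TransClosure (Γ X) u v
word⇒path {A = A} {[]} (A∈X ∷ []) u v eq =
  [ A , A∈X , trans eq (cong (proj₁ u ⊕_) (⊕-identityʳ A)) ]
word⇒path {A = A} {B ∷ w} (A∈X ∷ w∈𝓕) (U , U∈𝓐) v eq =
  (A , A∈X , refl) ∷ word⇒path w∈𝓕 (U ⊕ A , add U∈𝓐 (gen A∈X)) v
    (trans eq (sym (⊕-assoc U A (α (B ∷ w)))))

path⇒word : ∀ {u v} → TransClosure (Γ X) u v →
  ∃[ A ] ∃[ w ] (A ∷ w) ∈ 𝓕 X × proj₁ v ≡ proj₁ u ⊕ α (A ∷ w)
path⇒word {u = U , _} [ A , A∈X , eq ] =
  A , [] , A∈X ∷ [] , trans eq (cong (U ⊕_) (sym (⊕-identityʳ A)))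
path⇒word {u = U , _} ((A , A∈X , eq) ∷ path) with path⇒word path
... | B , w , Bw∈𝓕 , eq′ = A , B ∷ w , A∈X ∷ Bw∈𝓕
  , trans eq′ (trans (cong (_⊕ α (B ∷ w)) eq) (⊕-assoc U A (α (B ∷ w))))

zeroWord⇒cycles : ZeroWord X → HasNonTrivialCycles (Γ X)
zeroWord⇒cycles (A , w , Aw∈𝓕 , αAw≡O) =
  (O , unit) , word⇒path Aw∈𝓕 (O , unit) (O , unit) (sym (cong (O ⊕_) αAw≡O))

-- The labels along the cycle add up to its displacement, which is O by cancellation in ℤ².
cycles⇒zeroWord : HasNonTrivialCycles (Γ X) → ZeroWord X
cycles⇒zeroWord ((U , _) , cycle) with path⇒word cycle
... | A , w , Aw∈𝓕 , eq = A , w , Aw∈𝓕 , ⊕-identityʳ-unique U (α (A ∷ w)) eq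

theorem2p19 : ∀ {ℓ : Level} (X : Pred ℤ² ℓ) → ¬ (O ∈ X) →
    (IPP X ⇔ (ι O ∈ Conv X))
    × ((ι O ∈ Conv X) ⇔ HasNonTrivialUnits (𝓐-monoid X))
    × (HasNonTrivialUnits (𝓐-monoid X) ⇔ HasNonTrivialCycles (Γ X))
theorem2p19 X O∉X =
    mk⇔ (zeroWord⇒conv ∘ IPP⇒zeroWord) (zeroWord⇒IPP ∘ conv⇒zeroWord O∉X)
  , mk⇔ (zeroWord⇒units O∉X ∘ conv⇒zeroWord O∉X) (zeroWord⇒conv ∘ units⇒zeroWord)
  , mk⇔ (zeroWord⇒cycles ∘ units⇒zeroWord) (zeroWord⇒units O∉X ∘ cycles⇒zeroWord)
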